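{- Let $k,n$ be positive integers with $k\le n$. Then $F(k,n)=k$.
   Context: Clear Mastermind with $n\ge 1$ positions and $k\ge 1$ codes: write $[k]=\{1,\dots,k\}$. A codemaker fixes a secret answer $y=(y_1,\dots,y_n)\in[k]^n$. In each round the codebreaker submits a guess $x\in[k]^n$ (any string, chosen adaptively from previous guesses and feedback) and receives feedback $\pi(x,y)\in\{\mathrm{G},\mathrm{Y},\mathrm{B}\}^n$ defined as follows: for every position $i$ with $x_i=y_i$, $\pi_i=\mathrm{G}$. Let $M$ be the multiset $\{y_i : x_i\ne y_i\}$ of answer codes at non-G positions. Then scan the non-G positions $j$ in increasing order: if $x_j$ currently occurs in $M$, set $\pi_j=\mathrm{Y}$ and remove one copy of $x_j$ from $M$; otherwise set $\pi_j=\mathrm{B}$. (E.g. answer $(2,1,3,4,2)$, guess $(2,2,2,2,4)$ gives $(\mathrm{G},\mathrm{Y},\mathrm{B},\mathrm{B},\mathrm{Y})$; answer $(1,1,2,3,3)$, guess $(1,1,1,2,3)$ gives $(\mathrm{G},\mathrm{G},\mathrm{B},\mathrm{Y},\mathrm{G})$.) The codebreaker finds the answer in $m$ rounds if her $m$-th guess equals $y$. $F(k,n)$ is the least $m$ such that the codebreaker has a strategy that, for every answer $y\in[k]^n$, makes a guess equal to $y$ within the first $m$ rounds. -}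

module Defs where

open import Data.Nat using (ℕ; zero; suc; _≤_)
open import Data.Fin using (Fin; _≟_)
open import Data.Vec using (Vec; toList; zip)
open import Data.List using (List; []; _∷_)
open import Data.List.Membership.Propositional using (_∈_)
open import Data.Maybe using (Maybe; just; nothing)
open import Data.Product using (Σ; _×_; _,_)
open import Relation.Nullary using (yes; no)

data Colour : Set where
  G Y B : Colour

Word : ℕ → ℕ → Set
Word k n = Vec (Fin k) n

removeOne : ∀ {k} → Fin k → List (Fin k) → Maybe (List (Fin k))
removeOne a [] = nothing
removeOne a (b ∷ M) with a ≟ b
... | yes _ = just M
... | no _ with removeOne a M
...   | just M' = just (b ∷ M')
...   | nothing = nothing

nonGreen : ∀ {k} → List (Fin k × Fin k) → List (Fin k)
nonGreen [] = []
nonGreen ((a , b) ∷ ps) with a ≟ b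
... | yes _ = nonGreen ps
... | no _ = b ∷ nonGreen ps

scan : ∀ {k} → List (Fin k × Fin k) → List (Fin k) → List Colour
scan [] M = []
scan ((a , b) ∷ ps) M with a ≟ b
... | yes _ = G ∷ scan ps M
... | no _ with removeOne a M
...   | just M' = Y ∷ scan ps M'
...   | nothing = B ∷ scan ps M

-- feedback π(x , y) for guess x and answer y (list of length n)
feedback : ∀ {k n} → Word k n → Word k n → List Colour
feedback x y = scan ps (nonGreen ps)
  where ps = toList (zip x y)

-- history of previous rounds: most recent round first
History : ℕ → ℕ → Set
History k n = List (Word k n × List Colour)

Strategy : ℕ → ℕ → Set
Strategy k n = History k n → Word k n

playFrom : ∀ {k n} → Strategy k n → Word k n → History k n → ℕ → List (Word k n)
playFrom s y h zero = []
playFrom s y h (suc m) = g ∷ playFrom s y ((g , feedback g y) ∷ h) m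
  where g = s h

play : ∀ {k n} → Strategy k n → Word k n → ℕ → List (Word k n)
play s y m = playFrom s y [] m

SolvableIn : ℕ → ℕ → ℕ → Set
SolvableIn k n m = Σ (Strategy k n) λ s → ∀ (y : Word k n) → y ∈ play s y m

FIs : ℕ → ℕ → ℕ → Set
FIs k n v = SolvableIn k n v × (∀ m → SolvableIn k n m → v ≤ m)

{-# OPTIONS --safe #-}
-- Upper bound: guess 1 everywhere, then keep the green positions and increment
-- all others.  The guess of round t is min (yᵢ , t) (counting codes and rounds
-- from 0), so round k - 1 guesses y.
--
-- Lower bound: the feedback is determined by the green positions and the
-- multiset of codes of the answer.  An adversary keeps an answer y and a nonempty
-- set P of positions on which y has never been green, such that each code not
-- yet guessed at a position of P occurs in y somewhere on P.  When a new guess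
-- hits y at s ∈ P, draw an arrow i → j if yⱼ may still be placed at i.  If s lies
-- on a cycle, rotating y along the cycle removes the hit and creates no new one;
-- otherwise P is replaced by the set of positions reachable from s, which is
-- nonempty as long as some code is still unguessed at s.  Hence y survives any
-- k - 1 guesses.
module Submission where

open import Defs
open import Data.Empty using (⊥-elim)
open import Data.Nat using (ℕ; zero; suc; _+_; _≤_; _<_; _⊓_; s≤s; s≤s⁻¹)
open import Data.Nat.Properties as ℕ using (m≤n⇒∃[o]m+o≡n)
open import Algebra.Properties.CommutativeSemigroup ℕ.+-commutativeSemigroup
  using (x∙yz≈y∙xz; interchange)
open import Data.Fin using (Fin; zero; suc; toℕ; _≟_; _↑ˡ_)
open import Data.Fin.Properties
  using (any?; injective⇒≤; toℕ-injective; toℕ<n)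
open import Data.Fin.Subset using (Subset; _∈_; _∉_; _⊆_; _⊃_; _∪_; ⁅_⁆; ⊤; ⊥)
open import Data.Fin.Subset.Properties
  using (_∈?_; x∈p∪q⁺; x∈p∪q⁻; x∈⁅x⁆; x∈⁅y⁆⇒x≡y; ∈⊤; ∉⊥)
open import Data.Fin.Subset.Induction using (Acc; acc; ⊃-wellFounded)
open import Data.List as List using (List; []; _∷_; length)
open import Data.List.Membership.Propositional as List using ()
open import Data.List.Membership.Propositional.Properties using (∈-allFin)
open import Data.List.Relation.Unary.All as All using (All; []; _∷_)
open import Data.List.Relation.Unary.All.Properties using (¬All⇒Any¬)
open import Data.List.Relation.Unary.Any as Any using (Any; here; there)
open import Data.List.Relation.Unary.Any.Properties using (lookup-index)
open import Data.Maybe using (just; nothing)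
open import Data.Product using (Σ; ∃; _×_; _,_; proj₁; proj₂)
open import Data.Sum using (_⊎_; inj₁; inj₂)
open import Data.Vec as Vec using (Vec; []; _∷_; lookup; _[_]≔_; toList; zip)
open import Data.Vec.Properties
  using (lookup∘update; lookup∘update′; lookup-replicate;
         lookup-++ˡ; lookup-allFin)
open import Data.Vec.Relation.Binary.Pointwise.Extensional using (ext; Pointwise-≡⇒≡)
open import Function using (_∘_; id; case_of_)
open import Relation.Binary.PropositionalEquality
open import Relation.Nullary using (¬_; Dec; yes; no; contradiction)
open import Relation.Nullary.Decidable
  using (¬?; decidable-stable; _×-dec_; _⊎-dec_)
open import Relation.Unary using (Decidable)

private
  variable
    k n : ℕ

-- Multisets of codes, and what the feedback depends on.

indicator : Fin k → Fin k → ℕ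
indicator c b with c ≟ b
... | yes _ = 1
... | no _  = 0

indicator-refl : (c : Fin k) → indicator c c ≡ 1
indicator-refl c with c ≟ c
... | yes _   = refl
... | no c≢c = contradiction refl c≢c

multiplicity : Fin k → List (Fin k) → ℕ
multiplicity c []      = 0
multiplicity c (b ∷ M) = indicator c b + multiplicity c M

_≋_ : List (Fin k) → List (Fin k) → Set
M ≋ N = ∀ c → multiplicity c M ≡ multiplicity c N

removeOne-just : (a : Fin k) (M : List (Fin k)) {N : List (Fin k)} →
                 removeOne a M ≡ just N → M ≋ (a ∷ N)
removeOne-just a (b ∷ M) eq c with a ≟ b
removeOne-just a (b ∷ M) refl c | yes refl = refl
... | no _ with removeOne a M in eq′
removeOne-just a (b ∷ M) refl c | no _ | just N =
  trans (cong (indicator c b +_) (removeOne-just a M eq′ c))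
        (x∙yz≈y∙xz (indicator c b) (indicator c a) (multiplicity c N))

removeOne-nothing : (a : Fin k) (M : List (Fin k)) →
                    removeOne a M ≡ nothing → multiplicity a M ≡ 0
removeOne-nothing a [] eq = refl
removeOne-nothing a (b ∷ M) eq with a ≟ b
... | no _ with removeOne a M in eq′
...   | nothing = removeOne-nothing a M eq′

removeOne-absent : (a : Fin k) (M N : List (Fin k)) {M′ : List (Fin k)} → M ≋ N →
                   removeOne a M ≡ just M′ → ¬ removeOne a N ≡ nothing
removeOne-absent a M N {M′} M≋N eqM eqN = ℕ.0≢1+n (begin
  0                                    ≡⟨ removeOne-nothing a N eqN ⟨
  multiplicity a N                     ≡⟨ M≋N a ⟨
  multiplicity a M                     ≡⟨ removeOne-just a M eqM a ⟩
  indicator a a + multiplicity a M′    ≡⟨ cong (_+ multiplicity a M′) (indicator-refl a) ⟩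
  suc (multiplicity a M′)              ∎)
  where open ≡-Reasoning

-- Equivalent to `x` being green against `y` and `z` at the same positions, since a common green
-- forces equal codes. The disjunction is the form in which the adversary changes an answer.
SameGreens : Word k n → Word k n → Word k n → Set
SameGreens x y z = ∀ i → lookup y i ≡ lookup z i ⊎
                         (lookup x i ≢ lookup y i × lookup x i ≢ lookup z i)

-- `removeOne` succeeds on both multisets or on neither, and after two successes the removed code
-- cancels from the multiplicities, so the induction goes through.
scan-cong : (x y z : Word k n) → SameGreens x y z → {M N : List (Fin k)} → M ≋ N →
            scan (toList (zip x y)) M ≡ scan (toList (zip x z)) N
scan-cong [] [] [] same M≋N = refl
scan-cong (a ∷ x) (b ∷ y) (d ∷ z) same {M} {N} M≋N with a ≟ b | a ≟ d | same zero
... | yes _   | yes _   | _                = cong (G ∷_) (scan-cong x y z (same ∘ suc) M≋N)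
... | yes a≡b | no a≢d  | inj₁ b≡d         = contradiction (trans a≡b b≡d) a≢d
... | yes a≡b | no _    | inj₂ (a≢b , _)   = contradiction a≡b a≢b
... | no a≢b  | yes a≡d | inj₁ b≡d         = contradiction (trans a≡d (sym b≡d)) a≢b
... | no _    | yes a≡d | inj₂ (_ , a≢d)   = contradiction a≡d a≢d
... | no _    | no _    | _ with removeOne a M in eqM | removeOne a N in eqN
...   | just M′ | just N′ = cong (Y ∷_) (scan-cong x y z (same ∘ suc) λ c →
          ℕ.+-cancelˡ-≡ (indicator c a) _ _
            (trans (sym (removeOne-just a M eqM c)) (trans (M≋N c) (removeOne-just a N eqN c))))
...   | just _  | nothing = contradiction eqN (removeOne-absent a M N M≋N eqM)
...   | nothing | just _  = contradiction eqM (removeOne-absent a N M (sym ∘ M≋N) eqN)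
...   | nothing | nothing = cong (B ∷_) (scan-cong x y z (same ∘ suc) M≋N)

-- Both sides count the codes of y and of z outside the greens, plus the greens.
nonGreen-multiplicity : (x y z : Word k n) → SameGreens x y z → ∀ c →
  multiplicity c (nonGreen (toList (zip x y))) + multiplicity c (toList z) ≡
  multiplicity c (nonGreen (toList (zip x z))) + multiplicity c (toList y)
nonGreen-multiplicity [] [] [] same c = refl
nonGreen-multiplicity (a ∷ x) (b ∷ y) (d ∷ z) same c
  with a ≟ b | a ≟ d | same zero | nonGreen-multiplicity x y z (same ∘ suc) c
... | yes a≡b | no a≢d  | inj₁ b≡d         | _ = contradiction (trans a≡b b≡d) a≢d
... | yes a≡b | no _    | inj₂ (a≢b , _)   | _ = contradiction a≡b a≢b
... | no a≢b  | yes a≡d | inj₁ b≡d         | _ = contradiction (trans a≡d (sym b≡d)) a≢b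
... | no _    | yes a≡d | inj₂ (_ , a≢d)   | _ = contradiction a≡d a≢d
... | yes refl | yes refl | _              | ih =
  trans (x∙yz≈y∙xz (multiplicity c (nonGreen (toList (zip x y)))) (indicator c a) _)
    (trans (cong (indicator c a +_) ih)
           (x∙yz≈y∙xz (indicator c a) (multiplicity c (nonGreen (toList (zip x z)))) _))
... | no _    | no _    | _                | ih =
  trans (interchange (indicator c b) _ (indicator c d) _)
    (trans (cong₂ _+_ (ℕ.+-comm (indicator c b) (indicator c d)) ih)
           (sym (interchange (indicator c d) _ (indicator c b) _)))

-- Permuting the codes of an answer without touching the greens is invisible to the codebreaker.
feedback-cong : (x y z : Word k n) → SameGreens x y z → toList y ≋ toList z →
                feedback x y ≡ feedback x z
feedback-cong x y z same y≋z = scan-cong x y z same λ c →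
  ℕ.+-cancelʳ-≡ (multiplicity c (toList z)) _ _
    (trans (nonGreen-multiplicity x y z same c)
           (cong (multiplicity c (nonGreen (toList (zip x z))) +_) (y≋z c)))

-- Swapping two codes of a word.

swap : Word k n → Fin n → Fin n → Word k n
swap w i j = (w [ i ]≔ lookup w j) [ j ]≔ lookup w i

lookup-swap₁ : (w : Word k n) {i j : Fin n} → i ≢ j → lookup (swap w i j) i ≡ lookup w j
lookup-swap₁ w {i} {j} i≢j =
  trans (lookup∘update′ i≢j (w [ i ]≔ lookup w j) _) (lookup∘update i w _)

lookup-swap₂ : (w : Word k n) (i j : Fin n) → lookup (swap w i j) j ≡ lookup w i
lookup-swap₂ w i j = lookup∘update j (w [ i ]≔ lookup w j) _

lookup-swap-other : (w : Word k n) {i j l : Fin n} → l ≢ i → l ≢ j →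
                    lookup (swap w i j) l ≡ lookup w l
lookup-swap-other w {i} {j} l≢i l≢j =
  trans (lookup∘update′ l≢j (w [ i ]≔ lookup w j) _) (lookup∘update′ l≢i w _)

-- The overwritten code is added on the left instead of being subtracted on the right, which keeps
-- the count free of truncated subtraction.
multiplicity-update : (c : Fin k) (w : Word k n) (i : Fin n) (v : Fin k) →
  indicator c (lookup w i) + multiplicity c (toList (w [ i ]≔ v)) ≡
  indicator c v + multiplicity c (toList w)
multiplicity-update c (b ∷ w) zero v =
  x∙yz≈y∙xz (indicator c b) (indicator c v) _
multiplicity-update c (b ∷ w) (suc i) v =
  trans (x∙yz≈y∙xz (indicator c (lookup w i)) (indicator c b) _)
    (trans (cong (indicator c b +_) (multiplicity-update c w i v))
           (x∙yz≈y∙xz (indicator c b) (indicator c v) _))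

swap-≋ : (w : Word k n) {i j : Fin n} → i ≢ j → toList (swap w i j) ≋ toList w
swap-≋ w {i} {j} i≢j c = ℕ.+-cancelˡ-≡ (indicator c (lookup w j)) _ _ (begin
  indicator c (lookup w j) + multiplicity c (toList (swap w i j))
    ≡⟨ cong (λ v → indicator c v + multiplicity c (toList (swap w i j)))
            (lookup∘update′ (i≢j ∘ sym) w _) ⟨
  indicator c (lookup w₁ j) + multiplicity c (toList (swap w i j))
    ≡⟨ multiplicity-update c w₁ j (lookup w i) ⟩
  indicator c (lookup w i) + multiplicity c (toList w₁)
    ≡⟨ multiplicity-update c w i (lookup w j) ⟩
  indicator c (lookup w j) + multiplicity c (toList w) ∎)
  where
  open ≡-Reasoning
  w₁ = w [ i ]≔ lookup w j

_Covers_on_ : Word k n → Fin k → Subset n → Set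
w Covers c on P = ∃ λ j → j ∈ P × lookup w j ≡ c

swap-covers : (w : Word k n) {P : Subset n} {i j : Fin n} → i ≢ j → i ∈ P → j ∈ P →
              ∀ {c} → w Covers c on P → swap w i j Covers c on P
swap-covers w {P} {i} {j} i≢j i∈P j∈P (l , l∈P , wl≡c) with l ≟ i | l ≟ j
... | yes refl | _        = j , j∈P , trans (lookup-swap₂ w i j) wl≡c
... | no _     | yes refl = i , i∈P , trans (lookup-swap₁ w i≢j) wl≡c
... | no l≢i   | no l≢j   = l , l∈P , trans (lookup-swap-other w l≢i l≢j) wl≡c

-- Removing one hit: cycles and reachable sets.

module Removal (ok : Fin n → Fin k → Set) (ok? : ∀ i c → Dec (ok i c))
               (some-ok : ∀ i → ∃ (ok i)) where

  -- Read `ok i c` as: code `c` may still be placed at `i`. The arrows from `i` to `j` are given by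
  -- `ok i (lookup y j)`, and by `closed` each code allowed at a position of `P` yields an arrow
  -- that stays in `P`.
  module Search (y : Word k n) (P : Subset n) (s : Fin n) (s∈P : s ∈ P)
                (s-hit : ¬ ok s (lookup y s))
                (closed : ∀ {i c} → i ∈ P → ok i c → y Covers c on P) where

    -- The first alternative excludes `s`, so a word settled everywhere is no longer hit at `s`. The
    -- second records that codes change only inside `P`.
    Settled : Word k n → Fin n → Set
    Settled w i = (i ≢ s × lookup w i ≡ lookup y i) ⊎ (i ∈ P × ok i (lookup w i))

    -- The result of rotating y along a path from s to j: the code of s has
    -- moved to j, where it need not be admissible.
    record Rotated (R : Subset n) (j : Fin n) : Set where
      field
        word      : Word k n
        ≋y        : toList word ≋ toList y
        covers    : ∀ {c} → y Covers c on P → word Covers c on P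
        displaced : lookup word j ≡ lookup y s
        untouched : ∀ {i} → i ≢ s → i ∉ R → lookup word i ≡ lookup y i
        settled   : ∀ i → i ≢ j → Settled word i

    -- The source `s` is kept apart from `R`, because `R` is to become the smaller set that avoids
    -- `s`.
    Visited : Subset n → Fin n → Set
    Visited R i = i ≡ s ⊎ i ∈ R

    record Improved : Set where
      field
        word    : Word k n
        ≋y      : toList word ≋ toList y
        covers  : ∀ {c} → y Covers c on P → word Covers c on P
        settled : ∀ i → Settled word i

    record Reduced : Set where
      field
        R        : Subset n
        R⊆P      : R ⊆ P
        s∉R      : s ∉ R
        nonempty : ∃ (_∈ R)
        closed-R : ∀ {i c} → i ∈ R → ok i c → y Covers c on R

    visit⁻ : ∀ {R j i} → Visited (R ∪ ⁅ j ⁆) i → Visited R i ⊎ i ≡ j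
    visit⁻ (inj₁ i≡s) = inj₁ (inj₁ i≡s)
    visit⁻ {R} {j} (inj₂ i∈) with x∈p∪q⁻ R ⁅ j ⁆ i∈
    ... | inj₁ i∈R = inj₁ (inj₂ i∈R)
    ... | inj₂ i∈j = inj₂ (x∈⁅y⁆⇒x≡y j i∈j)

    weaken : ∀ {R j i} → Rotated R i → Rotated (R ∪ ⁅ j ⁆) i
    weaken r = record
      { Rotated r
      ; untouched = λ i≢s i∉ → Rotated.untouched r i≢s (i∉ ∘ x∈p∪q⁺ ∘ inj₁)
      }

    -- Lengthens the path by the arrow from `i` to `j`. As `j` is new, it still carries its code
    -- from `y`; the swap gives that code to `i`, where the arrow allows it, and carries the code of
    -- `s` on to `j`.
    extend : ∀ {R i j} → Visited R i → i ∈ P → ¬ Visited R j → j ∈ P → ok i (lookup y j) →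
             Rotated R i → Rotated (R ∪ ⁅ j ⁆) j
    extend {R} {i} {j} i-vis i∈P j-new j∈P arrow r = record
      { word      = swap word i j
      ; ≋y        = λ c → trans (swap-≋ word i≢j c) (≋y c)
      ; covers    = swap-covers word i≢j i∈P j∈P ∘ covers
      ; displaced = trans (lookup-swap₂ word i j) displaced
      ; untouched = untouched′
      ; settled   = settled′
      }
      where
      open Rotated r
      i≢j : i ≢ j
      i≢j refl = j-new i-vis

      at-i : lookup (swap word i j) i ≡ lookup y j
      at-i = trans (lookup-swap₁ word i≢j) (untouched (j-new ∘ inj₁) (j-new ∘ inj₂))

      untouched′ : ∀ {l} → l ≢ s → l ∉ R ∪ ⁅ j ⁆ → lookup (swap word i j) l ≡ lookup y l
      untouched′ {l} l≢s l∉ =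
        trans (lookup-swap-other word l≢i l≢j) (untouched l≢s (l∉ ∘ x∈p∪q⁺ ∘ inj₁))
        where
        l≢i : l ≢ i
        l≢i refl = case i-vis of λ
          { (inj₁ i≡s) → l≢s i≡s ; (inj₂ i∈R) → l∉ (x∈p∪q⁺ (inj₁ i∈R)) }
        l≢j : l ≢ j
        l≢j refl = l∉ (x∈p∪q⁺ (inj₂ (x∈⁅x⁆ j)))

      settled′ : ∀ l → l ≢ j → Settled (swap word i j) l
      settled′ l l≢j with l ≟ i
      ... | yes refl = inj₂ (i∈P , subst (ok i) (sym at-i) arrow)
      ... | no l≢i   = subst (λ v → (l ≢ s × v ≡ lookup y l) ⊎ (l ∈ P × ok l v))
                             (sym (lookup-swap-other word l≢i l≢j)) (settled l l≢i)

    start : Rotated ⊥ s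
    start = record
      { word = y ; ≋y = λ _ → refl ; covers = id ; displaced = refl
      ; untouched = λ _ _ → refl ; settled = λ _ i≢s → inj₁ (i≢s , refl) }

    visited? : ∀ R → Decidable (Visited R)
    visited? R i = (i ≟ s) ⊎-dec (i ∈? R)

    -- A graph search from `s`, terminating because `R` grows inside a finite set. Each visited
    -- position comes with a rotation along the path that discovered it.
    explore : ∀ R → Acc _⊃_ R → R ⊆ P → s ∉ R → (∀ {j} → Visited R j → Rotated R j) →
              Improved ⊎ Reduced
    explore R (acc rec) R⊆P s∉R rotated
      with any? (λ i → visited? R i ×-dec ok? i (lookup y s))
    -- An arrow from `i` back to `s` closes a cycle: the code of `s`, displaced to `i`, is allowed
    -- there, which settles the last position.
    ... | yes (i , i-vis , back) = inj₁ (record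
      { word = word ; ≋y = ≋y ; covers = covers ; settled = settled′ })
      where
      open Rotated (rotated i-vis)
      i∈P : i ∈ P
      i∈P = case i-vis of λ { (inj₁ refl) → s∈P ; (inj₂ i∈R) → R⊆P i∈R }
      settled′ : ∀ l → Settled word l
      settled′ l with l ≟ i
      ... | yes refl = inj₂ (i∈P , subst (ok i) (sym displaced) back)
      ... | no l≢i   = settled l l≢i
    ... | no no-back with any? (λ i → visited? R i ×-dec
                          any? (λ j → ¬? (visited? R j) ×-dec ((j ∈? P) ×-dec ok? i (lookup y j))))
    ...   | yes (i , i-vis , j , j-new , j∈P , arrow) =
      explore (R ∪ ⁅ j ⁆) (rec R⊂) R′⊆P s∉R′ rotated′
      where
      i∈P : i ∈ P
      i∈P = case i-vis of λ { (inj₁ refl) → s∈P ; (inj₂ i∈R) → R⊆P i∈R }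
      R⊂ : (R ∪ ⁅ j ⁆) ⊃ R
      R⊂ = (λ i∈R → x∈p∪q⁺ (inj₁ i∈R)) , j , x∈p∪q⁺ (inj₂ (x∈⁅x⁆ j)) , j-new ∘ inj₂
      R′⊆P : R ∪ ⁅ j ⁆ ⊆ P
      R′⊆P l∈ with x∈p∪q⁻ R ⁅ j ⁆ l∈
      ... | inj₁ l∈R = R⊆P l∈R
      ... | inj₂ l∈j = subst (_∈ P) (sym (x∈⁅y⁆⇒x≡y j l∈j)) j∈P
      s∉R′ : s ∉ R ∪ ⁅ j ⁆
      s∉R′ s∈ with x∈p∪q⁻ R ⁅ j ⁆ s∈
      ... | inj₁ s∈R = s∉R s∈R
      ... | inj₂ s∈j = j-new (inj₁ (sym (x∈⁅y⁆⇒x≡y j s∈j)))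
      rotated′ : ∀ {l} → Visited (R ∪ ⁅ j ⁆) l → Rotated (R ∪ ⁅ j ⁆) l
      rotated′ l-vis with visit⁻ {R} {j} l-vis
      ... | inj₁ old  = weaken (rotated old)
      ... | inj₂ refl = extend i-vis i∈P j-new j∈P arrow (rotated i-vis)
    -- The search is exhausted. A code allowed at a visited position has a carrier in `P`; the
    -- carrier `s` would close a cycle and an unvisited one would extend the search, so the carrier
    -- lies in `R`.
    ...   | no no-new = inj₂ (record
      { R = R ; R⊆P = R⊆P ; s∉R = s∉R
      ; nonempty = nonempty′
      ; closed-R = λ i∈R → covered (inj₂ i∈R) (R⊆P i∈R) })
      where
      covered : ∀ {i c} → Visited R i → i ∈ P → ok i c → y Covers c on R
      covered {i} {c} i-vis i∈P okc with closed i∈P okc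
      ... | j , j∈P , refl with visited? R j
      ...   | yes (inj₁ refl) = contradiction (i , i-vis , okc) no-back
      ...   | yes (inj₂ j∈R)  = j , j∈R , refl
      ...   | no j-new        = contradiction (i , i-vis , j , j-new , j∈P , okc) no-new
      -- Some code is still allowed at `s` itself, and its carrier lies in `R`.
      nonempty′ : ∃ (_∈ R)
      nonempty′ with covered (inj₁ refl) s∈P (proj₂ (some-ok s))
      ... | j , j∈R , _ = j , j∈R

    search : Improved ⊎ Reduced
    search = explore ⊥ (⊃-wellFounded ⊥) (⊥-elim ∘ ∉⊥) ∉⊥
      λ { (inj₁ refl) → start ; (inj₂ i∈⊥) → ⊥-elim (∉⊥ i∈⊥) }

-- The invariant of the adversary and its repair after a guess.

record Trap (ok ok′ : Fin n → Fin k → Set) (y : Word k n) (P : Subset n) : Set where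
  field
    nonempty : ∃ (_∈ P)
    safe     : ∀ {i} → i ∈ P → ok i (lookup y i)
    closed   : ∀ {i c} → i ∈ P → ok′ i c → y Covers c on P

-- With `ok` read as unguessed, these are answers that the guesses so far cannot tell apart: where
-- they differ, neither has been hit.
record Twin (ok : Fin n → Fin k → Set) (y z : Word k n) : Set where
  field
    ≋      : toList y ≋ toList z
    agrees : ∀ i → lookup y i ≡ lookup z i ⊎ (ok i (lookup y i) × ok i (lookup z i))

twin-refl : {ok : Fin n → Fin k → Set} {y : Word k n} → Twin ok y y
twin-refl = record { ≋ = λ _ → refl ; agrees = λ _ → inj₁ refl }

twin-trans : {ok : Fin n → Fin k → Set} {x y z : Word k n} →
             Twin ok x y → Twin ok y z → Twin ok x z
twin-trans {ok = ok} {x} {y} {z} s t = record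
  { ≋      = λ c → trans (Twin.≋ s c) (Twin.≋ t c)
  ; agrees = λ i → both i (Twin.agrees s i) (Twin.agrees t i) }
  where
  both : ∀ i → lookup x i ≡ lookup y i ⊎ (ok i (lookup x i) × ok i (lookup y i)) →
               lookup y i ≡ lookup z i ⊎ (ok i (lookup y i) × ok i (lookup z i)) →
               lookup x i ≡ lookup z i ⊎ (ok i (lookup x i) × ok i (lookup z i))
  both i (inj₁ p) (inj₁ q)             = inj₁ (trans p q)
  both i (inj₁ p) (inj₂ (oky , okz))   = inj₂ (subst (ok i) (sym p) oky , okz)
  both i (inj₂ (okx , oky)) (inj₁ q)   = inj₂ (okx , subst (ok i) q oky)
  both i (inj₂ (okx , _)) (inj₂ (_ , okz)) = inj₂ (okx , okz)

-- `ok` refers to the guesses before the new one, `ok′` includes it. During the repair a trap is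
-- closed for `ok′` but safe only for `ok`, as hits of the new guess may remain.
module _ {ok ok′ : Fin n → Fin k → Set} (ok′? : ∀ i c → Dec (ok′ i c))
         (some-ok′ : ∀ i → ∃ (ok′ i)) (ok′⇒ok : ∀ {i c} → ok′ i c → ok i c) where

  open Removal ok′ ok′? some-ok′

  -- Only the positions of P listed in L may still be hit by the new guess.
  shrink-trap : (L : List (Fin n)) {y : Word k n} {P : Subset n} → Trap ok ok′ y P →
                (∀ {i} → i ∈ P → ok′ i (lookup y i) ⊎ i List.∈ L) →
                ∃ λ z → ∃ λ Q → Trap ok′ ok′ z Q × Twin ok y z
  shrink-trap [] {y} {P} trap hits = y , P , record
    { Trap trap ; safe = λ i∈P → case hits i∈P of λ { (inj₁ o) → o ; (inj₂ ()) } } , twin-refl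
  shrink-trap (s ∷ L) {y} {P} trap hits with s ∈? P | ok′? s (lookup y s)
  ... | no s∉P  | _       = shrink-trap L trap λ i∈P → case hits i∈P of λ
    { (inj₁ o) → inj₁ o
    ; (inj₂ (here refl)) → contradiction i∈P s∉P
    ; (inj₂ (there i∈L)) → inj₂ i∈L }
  ... | yes _   | yes oks = shrink-trap L trap λ i∈P → case hits i∈P of λ
    { (inj₁ o) → inj₁ o
    ; (inj₂ (here refl)) → inj₁ oks
    ; (inj₂ (there i∈L)) → inj₂ i∈L }
  ... | yes s∈P | no s-hit with Search.search y P s s∈P s-hit (Trap.closed trap)
  -- The answer stays and the set shrinks to one that misses `s`.
  ...   | inj₂ red = shrink-trap L
    (record { nonempty = nonempty ; safe = Trap.safe trap ∘ R⊆P ; closed = closed-R })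
    λ i∈R → case hits (R⊆P i∈R) of λ
      { (inj₁ o) → inj₁ o
      ; (inj₂ (here refl)) → contradiction i∈R s∉R
      ; (inj₂ (there i∈L)) → inj₂ i∈L }
    where open Search.Reduced red
  -- The set stays and the answer is rotated. Every moved code is allowed after the new guess, so
  -- any remaining hit is an old one at a position other than `s`, hence listed in `L`.
  ...   | inj₁ imp with shrink-trap L trap′ hits′
    where
    open Trap trap
    open Search.Improved imp
    trap′ : Trap ok ok′ word P
    trap′ = record
      { nonempty = nonempty
      ; safe = λ {i} i∈P → case settled i of λ
          { (inj₁ (_ , eq)) → subst (ok i) (sym eq) (safe i∈P)
          ; (inj₂ (_ , o)) → ok′⇒ok o }
      ; closed = λ i∈P → covers ∘ closed i∈P }
    hits′ : ∀ {i} → i ∈ P → ok′ i (lookup word i) ⊎ i List.∈ L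
    hits′ {i} i∈P with settled i | hits i∈P
    ... | inj₂ (_ , o)    | _                  = inj₁ o
    ... | inj₁ (_ , eq)   | inj₁ o             = inj₁ (subst (ok′ i) (sym eq) o)
    ... | inj₁ (i≢s , _)  | inj₂ (here i≡s)    = contradiction i≡s i≢s
    ... | inj₁ _          | inj₂ (there i∈L)   = inj₂ i∈L
  ...     | z , Q , trap″ , twin = z , Q , trap″ , twin-trans (record
    { ≋ = sym ∘ ≋y
    ; agrees = λ i → case settled i of λ
        { (inj₁ (_ , eq)) → inj₁ (sym eq)
        ; (inj₂ (i∈P , o)) → inj₂ (Trap.safe trap i∈P , ok′⇒ok o) } }) twin
    where open Search.Improved imp

-- Histories and guesses of a play.

hist : Strategy k n → Word k n → ℕ → History k n
hist σ y zero    = []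
hist σ y (suc t) = (g , feedback g y) ∷ hist σ y t
  where g = σ (hist σ y t)

guesses : Strategy k n → Word k n → ℕ → List (Word k n)
guesses σ y t = List.map proj₁ (hist σ y t)

length-guesses : (σ : Strategy k n) (y : Word k n) (t : ℕ) → length (guesses σ y t) ≡ t
length-guesses σ y zero    = refl
length-guesses σ y (suc t) = cong suc (length-guesses σ y t)

guess-∈-play : (σ : Strategy k n) (y : Word k n) (t j m : ℕ) → j < m →
               σ (hist σ y (j + t)) List.∈ playFrom σ y (hist σ y t) m
guess-∈-play σ y t zero    (suc m) _         = here refl
guess-∈-play σ y t (suc j) (suc m) (s≤s j<m) =
  there (subst (λ u → σ (hist σ y u) List.∈ playFrom σ y (hist σ y (suc t)) m)
               (ℕ.+-suc j t) (guess-∈-play σ y (suc t) j m j<m))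

guesses-mono : (σ : Strategy k n) (y : Word k n) {z : Word k n} (m t : ℕ) →
               z List.∈ guesses σ y t → z List.∈ guesses σ y (m + t)
guesses-mono σ y zero    t z∈ = z∈
guesses-mono σ y (suc m) t z∈ = there (guesses-mono σ y m t z∈)

play-⊆-guesses : (σ : Strategy k n) (y : Word k n) {z : Word k n} (t m : ℕ) →
                 z List.∈ playFrom σ y (hist σ y t) m → z List.∈ guesses σ y (m + t)
play-⊆-guesses σ y t (suc m) (here refl) =
  subst (λ u → σ (hist σ y t) List.∈ guesses σ y u) (ℕ.+-suc m t)
        (guesses-mono σ y m (suc t) (here refl))
play-⊆-guesses σ y {z} t (suc m) (there z∈) =
  subst (λ u → z List.∈ guesses σ y u) (ℕ.+-suc m t) (play-⊆-guesses σ y (suc t) m z∈)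

-- The lower bound: an answer surviving fewer than `k` guesses.

Unguessed : List (Word k n) → Fin n → Fin k → Set
Unguessed xs i c = All (λ x → lookup x i ≢ c) xs

unguessed? : (xs : List (Word k n)) (i : Fin n) (c : Fin k) → Dec (Unguessed xs i c)
unguessed? xs i c = All.all? (λ x → ¬? (lookup x i ≟ c)) xs

-- Pigeonhole: if every code had been guessed at `i`, choosing a round for each code would inject
-- the codes into fewer rounds.
some-unguessed : (xs : List (Word k n)) → length xs < k → ∀ i → ∃ (Unguessed xs i)
some-unguessed {k} xs len<k i with any? (unguessed? xs i)
... | yes found = found
... | no  none  = contradiction (injective⇒≤ round-injective) (ℕ.<⇒≱ len<k)
  where
  guessed : ∀ c → Any (λ x → ¬ lookup x i ≢ c) xs
  guessed c = ¬All⇒Any¬ (λ x → ¬? (lookup x i ≟ c)) xs (λ all → none (c , all))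
  round : Fin k → Fin (length xs)
  round c = Any.index (guessed c)
  code-of-round : ∀ c → lookup (List.lookup xs (round c)) i ≡ c
  code-of-round c = decidable-stable (_ ≟ c) (lookup-index (guessed c))
  round-injective : ∀ {c d} → round c ≡ round d → c ≡ d
  round-injective {c} {d} eq = begin
    c                                    ≡⟨ code-of-round c ⟨
    lookup (List.lookup xs (round c)) i  ≡⟨ cong (λ r → lookup (List.lookup xs r) i) eq ⟩
    lookup (List.lookup xs (round d)) i  ≡⟨ code-of-round d ⟩
    d                                    ∎
    where open ≡-Reasoning

-- Equal histories produce the same next guess, and that guess has the same greens against both
-- twins, so `feedback-cong` extends the equality by a round.
twin-hist : (σ : Strategy k n) {y z : Word k n} (t : ℕ) →
            Twin (Unguessed (guesses σ y t)) y z → hist σ z t ≡ hist σ y t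
twin-hist σ zero _ = refl
twin-hist σ {y} {z} (suc t) twin
  rewrite twin-hist σ {y} {z} t (record
    { ≋ = Twin.≋ twin
    ; agrees = λ i → case Twin.agrees twin i of λ
        { (inj₁ eq) → inj₁ eq ; (inj₂ (p , q)) → inj₂ (All.tail p , All.tail q) } })
  = cong (λ f → (σ (hist σ y t) , f) ∷ hist σ y t)
      (sym (feedback-cong (σ (hist σ y t)) y z
        (λ i → case Twin.agrees twin i of λ
          { (inj₁ eq) → inj₁ eq ; (inj₂ (p , q)) → inj₂ (All.head p , All.head q) })
        (Twin.≋ twin)))

-- Before the first guess every code is unguessed everywhere, so the initial answer must show all
-- codes. Each later round repairs the trap, starting from the list of all positions, since the new
-- guess may hit anywhere.
trap-after : (σ : Strategy k n) (y₀ : Word k n) (P₀ : Subset n) → ∃ (_∈ P₀) →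
             (∀ c → y₀ Covers c on P₀) → (t : ℕ) → t < k →
             ∃ λ y → ∃ λ P → Trap (Unguessed (guesses σ y t)) (Unguessed (guesses σ y t)) y P
trap-after σ y₀ P₀ nonempty all-codes zero _ = y₀ , P₀ , record
  { nonempty = nonempty ; safe = λ _ → [] ; closed = λ _ _ → all-codes _ }
trap-after {k} σ y₀ P₀ nonempty all-codes (suc t) t+1<k
  with trap-after σ y₀ P₀ nonempty all-codes t (ℕ.<-trans (ℕ.n<1+n t) t+1<k)
... | y , P , trap
  with shrink-trap (unguessed? (guesses σ y (suc t)))
         (some-unguessed (guesses σ y (suc t))
           (subst (_< k) (sym (length-guesses σ y (suc t))) t+1<k))
         All.tail (List.allFin _)
         (record { Trap trap ; closed = λ i∈P → Trap.closed trap i∈P ∘ All.tail })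
         (λ _ → inj₂ (∈-allFin _))
-- The repaired trap speaks of the guesses made against `y`; the twin `z` has the same history up to
-- round `t` and so provokes the same new guess.
... | z , Q , trap′ , twin = z , Q ,
  subst (λ xs → Trap (Unguessed xs) (Unguessed xs) z Q)
        (cong (λ h → σ h ∷ List.map proj₁ h) (sym (twin-hist σ t twin))) trap′

-- Here the assumption that there are at least as many positions as codes enters: every code is
-- listed once and the rest is padding.
rainbow : suc k ≤ n → Σ (Word (suc k) n) λ y → ∀ c → y Covers c on ⊤
rainbow {k} k<n with m≤n⇒∃[o]m+o≡n k<n
... | o , refl = Vec.allFin (suc k) Vec.++ Vec.replicate o zero , λ c →
  c ↑ˡ o , ∈⊤ , trans (lookup-++ˡ (Vec.allFin (suc k)) _ c) (lookup-allFin c)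

lower-bound : suc k ≤ n → ∀ m → SolvableIn (suc k) n m → suc k ≤ m
lower-bound {k} k<n m (σ , solves) = ℕ.≮⇒≥ λ m<k →
  let y₀ , all-codes     = rainbow k<n
      y , P , trap       = trap-after σ y₀ ⊤ (proj₁ (all-codes zero) , ∈⊤) all-codes m m<k
      i , i∈P            = Trap.nonempty trap
      y∈guesses          = subst (λ u → y List.∈ guesses σ y u) (ℕ.+-identityʳ m)
                                 (play-⊆-guesses σ y 0 m (solves y))
  -- The answer would have to be among its own guesses, yet at the trapped position `i` no guess
  -- agrees with it.
  in All.lookup (Trap.safe trap i∈P) y∈guesses refl

-- The upper bound: the counting strategy.

-- The last code is sent to itself; it is never incremented in a play.
next : Fin (suc k) → Fin (suc k)
next {zero}  zero    = zero
next {suc k} zero    = suc zero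
next {suc k} (suc c) = suc (next c)

toℕ-next : (c d : Fin (suc k)) → toℕ c < toℕ d → toℕ (next c) ≡ suc (toℕ c)
toℕ-next {zero}  zero    zero    ()
toℕ-next {suc k} zero    d       _         = refl
toℕ-next {suc k} (suc c) (suc d) (s≤s c<d) = cong suc (toℕ-next c d c<d)

-- A wrong code `a` must equal `t` with `b` above `t`, since otherwise the minimum would be `b`
-- itself.
toℕ-next-⊓ : (a b : Fin (suc k)) (t : ℕ) → a ≢ b → toℕ a ≡ toℕ b ⊓ t →
             toℕ (next a) ≡ toℕ b ⊓ suc t
toℕ-next-⊓ a b t a≢b a≡b⊓t with ℕ.≤-<-connex (toℕ b) t
... | inj₁ b≤t = contradiction (toℕ-injective (trans a≡b⊓t (ℕ.m≤n⇒m⊓n≡m b≤t))) a≢b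
... | inj₂ t<b = begin
  toℕ (next a)    ≡⟨ toℕ-next a b (subst (_< toℕ b) (sym a≡t) t<b) ⟩
  suc (toℕ a)     ≡⟨ cong suc a≡t ⟩
  suc t           ≡⟨ ℕ.m≥n⇒m⊓n≡n t<b ⟨
  toℕ b ⊓ suc t   ∎
  where
  open ≡-Reasoning
  a≡t : toℕ a ≡ t
  a≡t = trans a≡b⊓t (ℕ.m≥n⇒m⊓n≡n (ℕ.<⇒≤ t<b))

refine : Word (suc k) n → List Colour → Word (suc k) n
refine []      f       = []
refine (a ∷ x) []      = a ∷ x
refine (a ∷ x) (G ∷ f) = a ∷ refine x f
refine (a ∷ x) (Y ∷ f) = next a ∷ refine x f
refine (a ∷ x) (B ∷ f) = next a ∷ refine x f

counting : Strategy (suc k) n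
counting []            = Vec.replicate _ zero
counting ((x , f) ∷ _) = refine x f

-- `M` is arbitrary because the scan changes it, while `refine` distinguishes only green from not
-- green.
refine-scan : (t : ℕ) (x y : Word (suc k) n) (M : List (Fin (suc k))) →
              (∀ i → toℕ (lookup x i) ≡ toℕ (lookup y i) ⊓ t) → ∀ i →
              toℕ (lookup (refine x (scan (toList (zip x y)) M)) i) ≡ toℕ (lookup y i) ⊓ suc t
refine-scan t (a ∷ x) (b ∷ y) M inv i with a ≟ b
refine-scan t (a ∷ x) (b ∷ y) M inv zero | yes refl =
  -- At a green position the invariant gives a code at most `t`, so raising the cap to `suc t`
  -- changes nothing.
  sym (ℕ.m≤n⇒m⊓n≡m (ℕ.m≤n⇒m≤1+n (ℕ.m⊓n≡m⇒m≤n (sym (inv zero)))))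
refine-scan t (a ∷ x) (b ∷ y) M inv (suc i) | yes refl = refine-scan t x y M (inv ∘ suc) i
... | no a≢b with removeOne a M
refine-scan t (a ∷ x) (b ∷ y) M inv zero    | no a≢b | just M′ = toℕ-next-⊓ a b t a≢b (inv zero)
refine-scan t (a ∷ x) (b ∷ y) M inv (suc i) | no a≢b | just M′ = refine-scan t x y M′ (inv ∘ suc) i
refine-scan t (a ∷ x) (b ∷ y) M inv zero    | no a≢b | nothing = toℕ-next-⊓ a b t a≢b (inv zero)
refine-scan t (a ∷ x) (b ∷ y) M inv (suc i) | no a≢b | nothing = refine-scan t x y M (inv ∘ suc) i

counting-guess : (y : Word (suc k) n) (t : ℕ) → ∀ i →
                 toℕ (lookup (counting (hist counting y t)) i) ≡ toℕ (lookup y i) ⊓ t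
counting-guess y zero i =
  trans (cong toℕ (lookup-replicate i zero)) (sym (ℕ.⊓-zeroʳ (toℕ (lookup y i))))
counting-guess y (suc t) = refine-scan t x y (nonGreen (toList (zip x y))) (counting-guess y t)
  where x = counting (hist counting y t)

-- With `suc k` codes counted from 0, every code is at most `k`, so the cap `k` has no effect after
-- `k` rounds of feedback.
counting-final : (y : Word (suc k) n) → counting (hist counting y k) ≡ y
counting-final {k} y = Pointwise-≡⇒≡ (ext λ i → toℕ-injective
  (trans (counting-guess y k i) (ℕ.m≤n⇒m⊓n≡m (s≤s⁻¹ (toℕ<n (lookup y i))))))

upper-bound : SolvableIn (suc k) n (suc k)
upper-bound {k} = counting , λ y →
  subst (List._∈ play counting y (suc k))
        (trans (cong (λ t → counting (hist counting y t)) (ℕ.+-identityʳ k)) (counting-final y))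
        (guess-∈-play counting y 0 k (suc k) (ℕ.n<1+n k))

theorem1 : (k n : ℕ) → 1 ≤ k → 1 ≤ n → k ≤ n → FIs k n k
theorem1 (suc k) n _ _ k≤n = upper-bound , lower-bound k≤n
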